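{- Let the alphabet be $\mathcal{A}=\{0,1,\dots,q-1\}$ with $G=\mathbb{Z}_q$ acting by $g\cdot i=g+i\pmod q$ letterwise on words. For a pattern $p$ of length $\ell\ge2$ and another pattern $p'$ (of length at least $2$), $$p\mathcal{L}p'=1+q\,\big(S(p)\,\mathrm{L}\,S(p')\big).$$ In particular, the expected number of independent uniformly random letters drawn until the drawn sequence first ends with a word of the orbit $p$ equals $1+q\,\big(S(p)\,\mathrm{L}\,S(p)\big)$.
   Context: A pattern is a $G$-orbit of words; $G_p$ denotes the stabilizer of the words of $p$. For patterns $p$ (length $\ell$) and $p'$, $\mathcal{C}_i(p,p')=|G_x|/|G_p|$ if the suffix $x=p(i+1,\ell)$ of length $\ell-i$ is in the same orbit as the prefix of $p'$ of length $\ell-i$, and $0$ otherwise ($0\le i\le\ell-1$); the pattern Conway leading number is $p\mathcal{L}p'=\sum_{i=0}^{\ell-1}\mathcal{C}_i(p,p')q^{\ell-1-i}$. For words $v$ (length $m$) and $w$, $C_i(v,w)=1$ if the suffix of $v$ of length $m-i$ equals the prefix of $w$ of length $m-i$ and $0$ otherwise, and the word Conway leading number is $v\,\mathrm{L}\,w=\sum_{i=0}^{m-1}C_i(v,w)q^{m-1-i}$. The adjacency signature of $p=p(1)\cdots p(\ell)$ is $S(p)=s(1)\cdots s(\ell-1)$ with $s(i)\equiv p(i+1)-p(i)\pmod q$. -}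

module Defs where

open import Data.Nat as ℕ using (ℕ; zero; suc; _∸_; _^_)
open import Data.Nat.DivMod using (_mod_)
open import Data.Fin using (Fin; toℕ)
open import Data.Fin.Properties using (any?) renaming (_≟_ to _≟F_)
open import Data.List using (List; []; _∷_; length; drop; take; map; filter; upTo; allFin)
open import Data.Nat.ListAction using (sum)
open import Data.List.Properties using (≡-dec)
open import Data.Integer using (+_)
open import Data.Rational as ℚ using (ℚ; 0ℚ; _/_)
open import Data.Product using (∃)
open import Relation.Binary.PropositionalEquality using (_≡_)
open import Relation.Nullary using (Dec; yes; no)

Word : ℕ → Set
Word q = List (Fin q)

_≟W_ : ∀ {q} (x y : Word q) → Dec (x ≡ y)
_≟W_ = ≡-dec _≟F_

shift : ∀ {q} → Fin q → Fin q → Fin q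
shift {suc k} g i = (toℕ g ℕ.+ toℕ i) mod suc k

act : ∀ {q} → Fin q → Word q → Word q
act g = map (shift g)

SameOrbit : ∀ {q} → Word q → Word q → Set
SameOrbit {q} x y = ∃ λ (g : Fin q) → act g x ≡ y

sameOrbit? : ∀ {q} (x y : Word q) → Dec (SameOrbit x y)
sameOrbit? x y = any? (λ g → act g x ≟W y)

stabSize : ∀ {q} → Word q → ℕ
stabSize {q} x = length (filter (λ g → act g x ≟W x) (allFin q))

-- a / b as a rational (b is always ≥ 1 in use: 0 stabilizes every word).
ratio : ℕ → ℕ → ℚ
ratio a zero    = 0ℚ
ratio a (suc b) = (+ a) / suc b

fromℕℚ : ℕ → ℚ
fromℕℚ n = (+ n) / 1

-- Pattern Conway coefficient C_i(p,p'), p given by a representative word.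
patC : ∀ {q} → Word q → Word q → ℕ → ℚ
patC p p' i with sameOrbit? (drop i p) (take (length p ∸ i) p')
... | yes _ = ratio (stabSize (drop i p)) (stabSize p)
... | no  _ = 0ℚ

sumℚ : List ℚ → ℚ
sumℚ []       = 0ℚ
sumℚ (x ∷ xs) = x ℚ.+ sumℚ xs

patL : ∀ {q} → Word q → Word q → ℚ
patL {q} p p' =
  sumℚ (map (λ i → patC p p' i ℚ.* fromℕℚ (q ^ (length p ∸ 1 ∸ i))) (upTo (length p)))

wordC : ∀ {q} → Word q → Word q → ℕ → ℕ
wordC v w i with drop i v ≟W take (length v ∸ i) w
... | yes _ = 1
... | no  _ = 0

wordL : ∀ {q} → Word q → Word q → ℕ
wordL {q} v w = sum (map (λ i → wordC v w i ℕ.* q ^ (length v ∸ 1 ∸ i)) (upTo (length v)))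

diff : ∀ {q} → Fin q → Fin q → Fin q
diff {suc k} a b = (toℕ b ℕ.+ (suc k ∸ toℕ a)) mod suc k

sig : ∀ {q} → Word q → Word q
sig (a ∷ b ∷ rest) = diff a b ∷ sig (b ∷ rest)
sig _              = []

-- Every nonempty word has trivial stabilizer under the cyclic shift action, so
-- every nonzero pattern coefficient is 1. A nonempty word is determined up to
-- shift by its adjacency signature, and the signature commutes with taking
-- suffixes and (shortened by one) prefixes; hence Cᵢ(p,p') = Cᵢ(S(p),S(p')) for
-- i < ℓ, the last one being the trivially matching single letter. Reading the
-- Conway number as a Horner evaluation in base q, the extra last digit 1
-- gives p𝓛p' = q · (S(p) L S(p')) + 1.
module Submission where

open import Defs
open import Data.Nat as ℕ using (ℕ; zero; suc; _∸_; _^_; _<_; _≤_; z≤n; _%_)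
open import Data.Nat.Properties
  using (≤-refl; +-comm; +-assoc; +-commutativeSemigroup; *-commutativeSemigroup;
         +-identityʳ; *-identityʳ; *-zeroʳ; *-distribˡ-+;
         ≤-<-trans; <⇒≤; n∸n≡0; ∸-+-assoc; +-∸-assoc; m+[n∸m]≡n; m∸n+n≡m; m<n⇒0<n∸m)
open import Algebra.Properties.CommutativeSemigroup +-commutativeSemigroup
  renaming (x∙yz≈y∙xz to +-left-comm) using ()
open import Algebra.Properties.CommutativeSemigroup *-commutativeSemigroup
  renaming (x∙yz≈y∙xz to *-left-comm) using ()
open import Data.Nat.DivMod using (%-distribˡ-+; m%n%n≡m%n; [m+n]%n≡m%n; m<n⇒m%n≡m)
open import Data.Nat.ListAction using (sum)
open import Data.Nat.ListAction.Properties using (sum-++)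
open import Data.Fin using (Fin; toℕ) renaming (zero to fzero; suc to fsuc)
open import Data.Fin.Properties using (toℕ-fromℕ<; toℕ-injective; toℕ<n)
open import Data.List
  using (List; []; _∷_; [_]; _∷ʳ_; _++_; length; drop; take; map; filter; tabulate; upTo)
open import Data.List.Properties
  using (∷-injective; map-cong; map-cong-local; map-id; map-∘; map-++; upTo-∷ʳ;
         length-drop; drop-all; take-[]; filter-accept; filter-none)
open import Data.List.Relation.Unary.All.Properties using (tabulate⁺; applyUpTo⁺₁)
open import Data.Integer as ℤ using (+_)
import Data.Integer.Properties as ℤ
open import Data.Nat.Coprimality using (1-coprimeTo) renaming (sym to coprime-sym)
open import Data.Rational using (mkℚ; 1ℚ; _+_; _*_)
open import Data.Rational.Properties using (normalize-coprime; /-cong)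
import Data.Rational.Properties as ℚ
open import Data.Product using (_,_; proj₁; proj₂)
open import Data.Empty using (⊥-elim)
open import Function using (_∘_; id)
open import Function.Bundles using (_⇔_; mk⇔; Equivalence)
open import Relation.Nullary using (¬_; yes; no)
open import Relation.Binary.PropositionalEquality using (_≡_; refl; sym; trans; cong; cong₂; subst; module ≡-Reasoning)

private
  variable
    k : ℕ

[m%n+o]%n≡[m+o]%n : ∀ m o n .{{_ : ℕ.NonZero n}} → (m % n ℕ.+ o) % n ≡ (m ℕ.+ o) % n
[m%n+o]%n≡[m+o]%n m o n = begin
  (m % n ℕ.+ o) % n            ≡⟨ %-distribˡ-+ (m % n) o n ⟩
  (m % n % n ℕ.+ o % n) % n    ≡⟨ cong (λ x → (x ℕ.+ o % n) % n) (m%n%n≡m%n m n) ⟩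
  (m % n ℕ.+ o % n) % n        ≡⟨ sym (%-distribˡ-+ m o n) ⟩
  (m ℕ.+ o) % n                ∎
  where open ≡-Reasoning

[m+o%n]%n≡[m+o]%n : ∀ m o n .{{_ : ℕ.NonZero n}} → (m ℕ.+ o % n) % n ≡ (m ℕ.+ o) % n
[m+o%n]%n≡[m+o]%n m o n = begin
  (m ℕ.+ o % n) % n  ≡⟨ cong (_% n) (+-comm m (o % n)) ⟩
  (o % n ℕ.+ m) % n  ≡⟨ [m%n+o]%n≡[m+o]%n o m n ⟩
  (o ℕ.+ m) % n      ≡⟨ cong (_% n) (+-comm o m) ⟩
  (m ℕ.+ o) % n      ∎
  where open ≡-Reasoning

toℕ-shift : (g a : Fin (suc k)) → toℕ (shift g a) ≡ (toℕ g ℕ.+ toℕ a) % suc k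
toℕ-shift g a = toℕ-fromℕ< _

toℕ-diff : (a b : Fin (suc k)) → toℕ (diff a b) ≡ (toℕ b ℕ.+ (suc k ∸ toℕ a)) % suc k
toℕ-diff a b = toℕ-fromℕ< _

toℕ%≡toℕ : (a : Fin (suc k)) → toℕ a % suc k ≡ toℕ a
toℕ%≡toℕ a = m<n⇒m%n≡m (toℕ<n a)

[m+a+[n∸a]]%n≡m : (m a : Fin (suc k)) →
  (toℕ m ℕ.+ toℕ a ℕ.+ (suc k ∸ toℕ a)) % suc k ≡ toℕ m
[m+a+[n∸a]]%n≡m {k} m a = begin
  (toℕ m ℕ.+ toℕ a ℕ.+ (suc k ∸ toℕ a)) % suc k    ≡⟨ cong (_% suc k) (+-assoc (toℕ m) (toℕ a) _) ⟩
  (toℕ m ℕ.+ (toℕ a ℕ.+ (suc k ∸ toℕ a))) % suc k  ≡⟨ cong (λ x → (toℕ m ℕ.+ x) % suc k) (m+[n∸m]≡n (<⇒≤ (toℕ<n a))) ⟩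
  (toℕ m ℕ.+ suc k) % suc k                        ≡⟨ [m+n]%n≡m%n (toℕ m) (suc k) ⟩
  toℕ m % suc k                                    ≡⟨ toℕ%≡toℕ m ⟩
  toℕ m                                            ∎
  where open ≡-Reasoning

[m+[n∸a]+a]%n≡m : (m a : Fin (suc k)) →
  (toℕ m ℕ.+ (suc k ∸ toℕ a) ℕ.+ toℕ a) % suc k ≡ toℕ m
[m+[n∸a]+a]%n≡m {k} m a = begin
  (toℕ m ℕ.+ (suc k ∸ toℕ a) ℕ.+ toℕ a) % suc k    ≡⟨ cong (_% suc k) (+-assoc (toℕ m) _ (toℕ a)) ⟩
  (toℕ m ℕ.+ ((suc k ∸ toℕ a) ℕ.+ toℕ a)) % suc k  ≡⟨ cong (λ x → (toℕ m ℕ.+ x) % suc k) (m∸n+n≡m (<⇒≤ (toℕ<n a))) ⟩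
  (toℕ m ℕ.+ suc k) % suc k                        ≡⟨ [m+n]%n≡m%n (toℕ m) (suc k) ⟩
  toℕ m % suc k                                    ≡⟨ toℕ%≡toℕ m ⟩
  toℕ m                                            ∎
  where open ≡-Reasoning

shift-identityˡ : (a : Fin (suc k)) → shift fzero a ≡ a
shift-identityˡ a = toℕ-injective (trans (toℕ-shift fzero a) (toℕ%≡toℕ a))

shift-comm : (g h a : Fin (suc k)) → shift g (shift h a) ≡ shift h (shift g a)
shift-comm {k} g h a = toℕ-injective (begin
  toℕ (shift g (shift h a))                 ≡⟨ toℕ-shift g _ ⟩
  (toℕ g ℕ.+ toℕ (shift h a)) % suc k       ≡⟨ cong (λ x → (toℕ g ℕ.+ x) % suc k) (toℕ-shift h a) ⟩
  (toℕ g ℕ.+ (toℕ h ℕ.+ toℕ a) % suc k) % suc k  ≡⟨ [m+o%n]%n≡[m+o]%n (toℕ g) _ (suc k) ⟩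
  (toℕ g ℕ.+ (toℕ h ℕ.+ toℕ a)) % suc k     ≡⟨ cong (_% suc k) (+-left-comm (toℕ g) (toℕ h) (toℕ a)) ⟩
  (toℕ h ℕ.+ (toℕ g ℕ.+ toℕ a)) % suc k     ≡⟨ sym ([m+o%n]%n≡[m+o]%n (toℕ h) _ (suc k)) ⟩
  (toℕ h ℕ.+ (toℕ g ℕ.+ toℕ a) % suc k) % suc k  ≡⟨ cong (λ x → (toℕ h ℕ.+ x) % suc k) (toℕ-shift g a) ⟨
  (toℕ h ℕ.+ toℕ (shift g a)) % suc k       ≡⟨ toℕ-shift h _ ⟨
  toℕ (shift h (shift g a))                 ∎)
  where open ≡-Reasoning

shift-diff : (a b : Fin (suc k)) → shift (diff a b) a ≡ b
shift-diff {k} a b = toℕ-injective (begin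
  toℕ (shift (diff a b) a)                                   ≡⟨ toℕ-shift (diff a b) a ⟩
  (toℕ (diff a b) ℕ.+ toℕ a) % suc k                         ≡⟨ cong (λ x → (x ℕ.+ toℕ a) % suc k) (toℕ-diff a b) ⟩
  ((toℕ b ℕ.+ (suc k ∸ toℕ a)) % suc k ℕ.+ toℕ a) % suc k    ≡⟨ [m%n+o]%n≡[m+o]%n (toℕ b ℕ.+ (suc k ∸ toℕ a)) (toℕ a) (suc k) ⟩
  (toℕ b ℕ.+ (suc k ∸ toℕ a) ℕ.+ toℕ a) % suc k              ≡⟨ [m+[n∸a]+a]%n≡m b a ⟩
  toℕ b                                                      ∎)
  where open ≡-Reasoning

diff-shift : (g a : Fin (suc k)) → diff a (shift g a) ≡ g
diff-shift {k} g a = toℕ-injective (begin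
  toℕ (diff a (shift g a))                                   ≡⟨ toℕ-diff a (shift g a) ⟩
  (toℕ (shift g a) ℕ.+ (suc k ∸ toℕ a)) % suc k              ≡⟨ cong (λ x → (x ℕ.+ (suc k ∸ toℕ a)) % suc k) (toℕ-shift g a) ⟩
  ((toℕ g ℕ.+ toℕ a) % suc k ℕ.+ (suc k ∸ toℕ a)) % suc k    ≡⟨ [m%n+o]%n≡[m+o]%n (toℕ g ℕ.+ toℕ a) (suc k ∸ toℕ a) (suc k) ⟩
  (toℕ g ℕ.+ toℕ a ℕ.+ (suc k ∸ toℕ a)) % suc k              ≡⟨ [m+a+[n∸a]]%n≡m g a ⟩
  toℕ g                                                      ∎)
  where open ≡-Reasoning

shift-cancelʳ : (g h a : Fin (suc k)) → shift g a ≡ shift h a → g ≡ h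
shift-cancelʳ g h a eq = trans (sym (diff-shift g a)) (trans (cong (diff a) eq) (diff-shift h a))

diff-shift-shift : (g a b : Fin (suc k)) → diff (shift g a) (shift g b) ≡ diff a b
diff-shift-shift g a b = begin
  diff (shift g a) (shift g b)                           ≡⟨ cong (λ x → diff (shift g a) (shift g x)) (shift-diff a b) ⟨
  diff (shift g a) (shift g (shift (diff a b) a))        ≡⟨ cong (diff (shift g a)) (shift-comm g (diff a b) a) ⟩
  diff (shift g a) (shift (diff a b) (shift g a))        ≡⟨ diff-shift (diff a b) (shift g a) ⟩
  diff a b                                               ∎
  where open ≡-Reasoning

shift-along-diff : (g a b c d : Fin (suc k)) →
  shift g a ≡ b → diff a c ≡ diff b d → shift g c ≡ d
shift-along-diff g a b c d g·a≡b a→c≡b→d = begin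
  shift g c                         ≡⟨ cong (shift g) (shift-diff a c) ⟨
  shift g (shift (diff a c) a)      ≡⟨ shift-comm g (diff a c) a ⟩
  shift (diff a c) (shift g a)      ≡⟨ cong₂ shift a→c≡b→d g·a≡b ⟩
  shift (diff b d) b                ≡⟨ shift-diff b d ⟩
  d                                 ∎
  where open ≡-Reasoning

act-identity : (x : Word (suc k)) → act fzero x ≡ x
act-identity x = trans (map-cong shift-identityˡ x) (map-id x)

stabSize-nonempty : (x : Word (suc k)) → 0 < length x → stabSize x ≡ 1
stabSize-nonempty {k} (a ∷ x) _ = begin
  length (filter fixes? (fzero ∷ tabulate fsuc))  ≡⟨ cong length (filter-accept fixes? {fzero} {tabulate fsuc} (act-identity (a ∷ x))) ⟩
  suc (length (filter fixes? (tabulate fsuc)))   ≡⟨ cong (suc ∘ length) (filter-none fixes? (tabulate⁺ nonzero-moves)) ⟩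
  1                                              ∎
  where
  open ≡-Reasoning
  fixes? = λ (g : Fin (suc k)) → act g (a ∷ x) ≟W (a ∷ x)
  nonzero-moves : (j : Fin k) → ¬ act (fsuc j) (a ∷ x) ≡ a ∷ x
  nonzero-moves j eq
    with () ← shift-cancelʳ (fsuc j) fzero a (trans (proj₁ (∷-injective eq)) (sym (shift-identityˡ a)))

length-sig : ∀ {q} (a : Fin q) (x : Word q) → length (sig (a ∷ x)) ≡ length x
length-sig a []      = refl
length-sig a (b ∷ x) = cong suc (length-sig b x)

sig-drop : ∀ {q} i (x : Word q) → sig (drop i x) ≡ drop i (sig x)
sig-drop zero    x           = refl
sig-drop (suc i) []          = refl
sig-drop (suc i) (a ∷ [])    = cong sig (drop-all i [] z≤n)
sig-drop (suc i) (a ∷ b ∷ x) = sig-drop i (b ∷ x)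

sig-take : ∀ {q} n (x : Word q) → sig (take (suc n) x) ≡ take n (sig x)
sig-take n       []          = sym (take-[] n)
sig-take n       (a ∷ [])    = trans (cong (sig ∘ (a ∷_)) (take-[] n)) (sym (take-[] n))
sig-take zero    (a ∷ b ∷ x) = refl
sig-take (suc n) (a ∷ b ∷ x) = cong (diff a b ∷_) (sig-take n (b ∷ x))

sig-act : (g : Fin (suc k)) (x : Word (suc k)) → sig (act g x) ≡ sig x
sig-act g []          = refl
sig-act g (a ∷ [])    = refl
sig-act g (a ∷ b ∷ x) = cong₂ _∷_ (diff-shift-shift g a b) (sig-act g (b ∷ x))

act-from-sig : (g a b : Fin (suc k)) (x y : Word (suc k)) →
  shift g a ≡ b → sig (a ∷ x) ≡ sig (b ∷ y) → act g (a ∷ x) ≡ b ∷ y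
act-from-sig g a b []      []      g·a≡b _  = cong [_] g·a≡b
act-from-sig g a b (c ∷ x) (d ∷ y) g·a≡b eq = cong₂ _∷_ g·a≡b
  (act-from-sig g c d x y (shift-along-diff g a b c d g·a≡b (proj₁ (∷-injective eq))) (proj₂ (∷-injective eq)))

sameOrbit⇔sig≡ : (a b : Fin (suc k)) (x y : Word (suc k)) →
  SameOrbit (a ∷ x) (b ∷ y) ⇔ sig (a ∷ x) ≡ sig (b ∷ y)
sameOrbit⇔sig≡ a b x y = mk⇔
  (λ (g , g·ax≡by) → trans (sym (sig-act g (a ∷ x))) (cong sig g·ax≡by))
  (λ eq → diff a b , act-from-sig (diff a b) a b x y (shift-diff a b) eq)

sameOrbit-prefix⇔sig-prefix : (x : Word (suc k)) (c : Fin (suc k)) (y : Word (suc k)) → 0 < length x →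
  SameOrbit x (take (length x) (c ∷ y)) ⇔ sig x ≡ take (length (sig x)) (sig (c ∷ y))
sameOrbit-prefix⇔sig-prefix (a ∷ x) c y _ rewrite length-sig a x =
  subst (λ s → SameOrbit (a ∷ x) (c ∷ take (length x) y) ⇔ sig (a ∷ x) ≡ s)
        (sig-take (length x) (c ∷ y))
        (sameOrbit⇔sig≡ a c x (take (length x) y))

drop-nonempty : ∀ {A : Set} i (xs : List A) → i < length xs → 0 < length (drop i xs)
drop-nonempty i xs i<ℓ = subst (0 <_) (sym (length-drop i xs)) (m<n⇒0<n∸m i<ℓ)

sameOrbit-drop⇔sig-drop : (i : ℕ) (p : Word (suc k)) (c : Fin (suc k)) (y : Word (suc k)) → i < length p →
  SameOrbit (drop i p) (take (length p ∸ i) (c ∷ y))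
    ⇔ drop i (sig p) ≡ take (length (sig p) ∸ i) (sig (c ∷ y))
sameOrbit-drop⇔sig-drop i p c y i<ℓ
  rewrite sym (length-drop i p) | sym (length-drop i (sig p)) | sym (sig-drop i p) =
  sameOrbit-prefix⇔sig-prefix (drop i p) c y (drop-nonempty i p i<ℓ)

patC≡wordC-sig : (i : ℕ) (p : Word (suc k)) (c : Fin (suc k)) (y : Word (suc k)) → i < length p →
  patC p (c ∷ y) i ≡ fromℕℚ (wordC (sig p) (sig (c ∷ y)) i)
patC≡wordC-sig i p c y i<ℓ
  with sameOrbit? (drop i p) (take (length p ∸ i) (c ∷ y))
     | drop i (sig p) ≟W take (length (sig p) ∸ i) (sig (c ∷ y))
... | yes _     | yes _  rewrite stabSize-nonempty (drop i p) (drop-nonempty i p i<ℓ)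
                              | stabSize-nonempty p (≤-<-trans z≤n i<ℓ) = refl
... | yes orbit | no ¬eq = ⊥-elim (¬eq (Equivalence.to   (sameOrbit-drop⇔sig-drop i p c y i<ℓ) orbit))
... | no ¬orbit | yes eq = ⊥-elim (¬orbit (Equivalence.from (sameOrbit-drop⇔sig-drop i p c y i<ℓ) eq))
... | no _      | no _   = refl

wordC-length : ∀ {q} (v w : Word q) → wordC v w (length v) ≡ 1
wordC-length v w with drop (length v) v ≟W take (length v ∸ length v) w
... | yes _ = refl
... | no ¬eq = ⊥-elim (¬eq (trans (drop-all (length v) v ≤-refl) (cong (λ n → take n w) (sym (n∸n≡0 (length v))))))

conwaySum : ℕ → (ℕ → ℕ) → ℕ → ℕ
conwaySum q c n = sum (map (λ i → c i ℕ.* q ^ (n ∸ 1 ∸ i)) (upTo n))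

sum-map-*ˡ : ∀ {A : Set} (q : ℕ) (f : A → ℕ) (xs : List A) →
  sum (map (λ x → q ℕ.* f x) xs) ≡ q ℕ.* sum (map f xs)
sum-map-*ˡ q f []       = sym (*-zeroʳ q)
sum-map-*ˡ q f (x ∷ xs) = trans (cong (q ℕ.* f x ℕ.+_) (sum-map-*ˡ q f xs)) (sym (*-distribˡ-+ q (f x) _))

conwaySum-suc : ∀ q c n → conwaySum q c (suc n) ≡ q ℕ.* conwaySum q c n ℕ.+ c n
conwaySum-suc q c n = begin
  sum (map term′ (upTo (suc n)))                            ≡⟨ cong (sum ∘ map term′) (upTo-∷ʳ n) ⟨
  sum (map term′ (upTo n ∷ʳ n))                             ≡⟨ cong sum (map-++ term′ (upTo n) [ n ]) ⟩
  sum (map term′ (upTo n) ++ [ term′ n ])                   ≡⟨ sum-++ (map term′ (upTo n)) [ term′ n ] ⟩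
  sum (map term′ (upTo n)) ℕ.+ (term′ n ℕ.+ 0)              ≡⟨ cong₂ ℕ._+_ shifted last ⟩
  q ℕ.* conwaySum q c n ℕ.+ c n                             ∎
  where
  open ≡-Reasoning
  term′ = λ i → c i ℕ.* q ^ (n ∸ i)
  term  = λ i → c i ℕ.* q ^ (n ∸ 1 ∸ i)
  shiftedTerm : ∀ {i} → i < n → term′ i ≡ q ℕ.* term i
  shiftedTerm {i} i<n = begin
    c i ℕ.* q ^ (n ∸ i)               ≡⟨ cong (λ e → c i ℕ.* q ^ e) (+-∸-assoc 1 i<n) ⟩
    c i ℕ.* q ^ suc (n ∸ suc i)       ≡⟨ cong (λ e → c i ℕ.* q ^ suc e) (∸-+-assoc n 1 i) ⟨
    c i ℕ.* (q ℕ.* q ^ (n ∸ 1 ∸ i))   ≡⟨ *-left-comm (c i) q _ ⟩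
    q ℕ.* term i                      ∎
  shifted : sum (map term′ (upTo n)) ≡ q ℕ.* conwaySum q c n
  shifted = trans (cong sum (map-cong-local (applyUpTo⁺₁ id n shiftedTerm))) (sum-map-*ˡ q term (upTo n))
  last : term′ n ℕ.+ 0 ≡ c n
  last rewrite n∸n≡0 n = trans (+-identityʳ _) (*-identityʳ (c n))

fromℕℚ≡mkℚ : ∀ n → fromℕℚ n ≡ mkℚ (+ n) 0 (coprime-sym (1-coprimeTo n))
fromℕℚ≡mkℚ n = normalize-coprime (coprime-sym (1-coprimeTo n))

fromℕℚ-+ : ∀ m n → fromℕℚ (m ℕ.+ n) ≡ fromℕℚ m + fromℕℚ n
fromℕℚ-+ m n = trans (/-cong numerators refl) (sym (cong₂ _+_ (fromℕℚ≡mkℚ m) (fromℕℚ≡mkℚ n)))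
  where
  numerators : + (m ℕ.+ n) ≡ (+ m) ℤ.* (+ 1) ℤ.+ (+ n) ℤ.* (+ 1)
  numerators = sym (trans (cong₂ ℤ._+_ (ℤ.*-identityʳ (+ m)) (ℤ.*-identityʳ (+ n))) (sym (ℤ.pos-+ m n)))

fromℕℚ-* : ∀ m n → fromℕℚ (m ℕ.* n) ≡ fromℕℚ m * fromℕℚ n
fromℕℚ-* m n = trans (/-cong (ℤ.pos-* m n) refl) (sym (cong₂ _*_ (fromℕℚ≡mkℚ m) (fromℕℚ≡mkℚ n)))

sumℚ-map-fromℕℚ : (ns : List ℕ) → sumℚ (map fromℕℚ ns) ≡ fromℕℚ (sum ns)
sumℚ-map-fromℕℚ []       = refl
sumℚ-map-fromℕℚ (n ∷ ns) = trans (cong (λ s → fromℕℚ n + s) (sumℚ-map-fromℕℚ ns)) (sym (fromℕℚ-+ n (sum ns)))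

patL≡conwaySum-sig : (p : Word (suc k)) (c : Fin (suc k)) (y : Word (suc k)) →
  patL p (c ∷ y) ≡ fromℕℚ (conwaySum (suc k) (wordC (sig p) (sig (c ∷ y))) (length p))
patL≡conwaySum-sig {k} p c y = begin
  sumℚ (map patTerm (upTo (length p)))                 ≡⟨ cong sumℚ (map-cong-local (applyUpTo⁺₁ id (length p) patTerm≡)) ⟩
  sumℚ (map (fromℕℚ ∘ wordTerm) (upTo (length p)))     ≡⟨ cong sumℚ (map-∘ (upTo (length p))) ⟩
  sumℚ (map fromℕℚ (map wordTerm (upTo (length p))))   ≡⟨ sumℚ-map-fromℕℚ (map wordTerm (upTo (length p))) ⟩
  fromℕℚ (sum (map wordTerm (upTo (length p))))        ∎
  where
  open ≡-Reasoning
  weight = λ i → suc k ^ (length p ∸ 1 ∸ i)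
  patTerm  = λ i → patC p (c ∷ y) i * fromℕℚ (weight i)
  wordTerm = λ i → wordC (sig p) (sig (c ∷ y)) i ℕ.* weight i
  patTerm≡ : ∀ {i} → i < length p → patTerm i ≡ fromℕℚ (wordTerm i)
  patTerm≡ {i} i<ℓ = trans (cong (_* fromℕℚ (weight i)) (patC≡wordC-sig i p c y i<ℓ)) (sym (fromℕℚ-* (wordC (sig p) (sig (c ∷ y)) i) (weight i)))

patL≡1+q*wordL-sig : (a c : Fin (suc k)) (x y : Word (suc k)) →
  patL (a ∷ x) (c ∷ y) ≡ 1ℚ + fromℕℚ (suc k) * fromℕℚ (wordL (sig (a ∷ x)) (sig (c ∷ y)))
patL≡1+q*wordL-sig {k} a c x y = begin
  patL (a ∷ x) (c ∷ y)                             ≡⟨ patL≡conwaySum-sig (a ∷ x) c y ⟩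
  fromℕℚ (conwaySum q C (suc (length x)))          ≡⟨ cong fromℕℚ (conwaySum-suc q C (length x)) ⟩
  fromℕℚ (q ℕ.* conwaySum q C (length x) ℕ.+ C (length x))
    ≡⟨ cong fromℕℚ (cong₂ (λ n d → q ℕ.* conwaySum q C n ℕ.+ d) (sym (length-sig a x)) lastDigit) ⟩
  fromℕℚ (q ℕ.* wordL S S′ ℕ.+ 1)                  ≡⟨ fromℕℚ-+ (q ℕ.* wordL S S′) 1 ⟩
  fromℕℚ (q ℕ.* wordL S S′) + 1ℚ                   ≡⟨ ℚ.+-comm (fromℕℚ (q ℕ.* wordL S S′)) 1ℚ ⟩
  1ℚ + fromℕℚ (q ℕ.* wordL S S′)                   ≡⟨ cong (λ s → 1ℚ + s) (fromℕℚ-* q (wordL S S′)) ⟩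
  1ℚ + fromℕℚ q * fromℕℚ (wordL S S′)              ∎
  where
  open ≡-Reasoning
  q  = suc k
  S  = sig (a ∷ x)
  S′ = sig (c ∷ y)
  C  = wordC S S′
  lastDigit : C (length x) ≡ 1
  lastDigit = subst (λ n → C n ≡ 1) (length-sig a x) (wordC-length S S′)

mainTheorem9 : (q : ℕ) (p p′ : List (Fin q)) →
    2 ≤ length p → 2 ≤ length p′ →
    patL p p′ ≡ 1ℚ + fromℕℚ q * fromℕℚ (wordL (sig p) (sig p′))
mainTheorem9 zero    (() ∷ _) _        _ _
mainTheorem9 (suc k) []       _        () _
mainTheorem9 (suc k) (a ∷ x)  []       _ ()
mainTheorem9 (suc k) (a ∷ x)  (c ∷ y)  _ _ = patL≡1+q*wordL-sig a c x y
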